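{- There exist infinitely many pairwise non-isomorphic connected graphs $G$, all of whose vertices have degree $3$ or $4$, such that $$u(G)\ <\ \sum_{x\in V(G)}\frac{d_G(x)-2}{d_G(x)+1}.$$
   Context: Graphs are finite, undirected, without loops and multiple edges. $V(G)$ is the vertex set of $G$ and $d_G(x)$ is the degree of the vertex $x$ in $G$. For a connected graph $G$, $u(G)$ is the maximum, over all spanning trees $F$ of $G$, of the number of leaves (vertices of degree $1$) of $F$. -}

module Defs where

open import Data.Bool.Base using (Bool; T)
open import Data.Fin.Base using (Fin)
open import Data.Fin.Subset using (Subset; ∣_∣)
open import Data.Integer.Base using (_⊖_)
open import Data.List.Base using (List; _∷_; _∷ʳ_; length)
open import Data.List.Relation.Unary.Linked using (Linked)
open import Data.List.Relation.Unary.Unique.Propositional using (Unique)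
open import Data.Nat.Base using (ℕ; suc; _≤_; NonZero; _≡ᵇ_)
open import Data.Product.Base using (Σ-syntax; ∃-syntax; _×_)
open import Data.Rational.Base using (ℚ; _/_)
open import Data.Rational.Properties using (+-0-commutativeMonoid)
open import Data.Vec.Base using (tabulate)
open import Function.Bundles using (_↔_; _⇔_; Inverse)
open import Level using (0ℓ)
open import Relation.Binary.Construct.Closure.ReflexiveTransitive using (Star)
open import Relation.Binary.Core using (Rel; _⇒_)
open import Relation.Binary.Definitions using (Symmetric; Irreflexive)
open import Relation.Binary.PropositionalEquality.Core using (_≡_)
open import Relation.Nullary.Negation.Core using (¬_)

open import Algebra.Properties.CommutativeMonoid.Sum +-0-commutativeMonoid using (sum)

record Graph (n : ℕ) : Set where
  field
    adj : Fin n → Fin n → Bool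

  Adj : Rel (Fin n) 0ℓ
  Adj x y = T (adj x y)

  field
    adj-sym    : Symmetric Adj
    adj-irrefl : Irreflexive _≡_ Adj

open Graph public using (Adj)

module _ {n : ℕ} (G : Graph n) where

  neighbours : Fin n → Subset n
  neighbours x = tabulate (Graph.adj G x)

  degree : Fin n → ℕ
  degree x = ∣ neighbours x ∣

  leaves : Subset n
  leaves = tabulate (λ x → degree x ≡ᵇ 1)

  Connected : Set
  Connected = NonZero n × (∀ x y → Star (Adj G) x y)

  -- The closed walk x, xs, x, whose vertices x ∷ xs are distinct.  The length
  -- bound rules out the walk back and forth along a single edge.
  IsCycle : Fin n → List (Fin n) → Set
  IsCycle x xs = 2 ≤ length xs × Unique (x ∷ xs) × Linked (Adj G) (x ∷ xs ∷ʳ x)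

  Acyclic : Set
  Acyclic = ∀ x xs → ¬ IsCycle x xs

  IsTree : Set
  IsTree = Connected × Acyclic

IsSpanningTree : ∀ {n} → Graph n → Graph n → Set
IsSpanningTree G F = (Adj F ⇒ Adj G) × IsTree F

-- u(G) = k.  The attainment clause makes k a genuine maximum, not merely an
-- upper bound.
MaxLeaves : ∀ {n} → Graph n → ℕ → Set
MaxLeaves G k =
  (∃[ F ] IsSpanningTree G F × ∣ leaves F ∣ ≡ k) ×
  (∀ F → IsSpanningTree G F → ∣ leaves F ∣ ≤ k)

-- d ⊖ 2 is the integer d - 2, with no truncation.
degreeSum : ∀ {n} → Graph n → ℚ
degreeSum G = sum (λ x → (degree G x ⊖ 2) / suc (degree G x))

_≅_ : ∀ {m n} → Graph m → Graph n → Set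
_≅_ {m} {n} G H =
  Σ[ f ∈ Fin m ↔ Fin n ]
    (∀ x y → Adj G x y ⇔ Adj H (Inverse.to f x) (Inverse.to f y))

{-# OPTIONS --safe #-}
module Submission where

-- Line up layers of 2, 2, 1, 1, 2, 2, 1, 1, …, 2, 2 vertices and join any two
-- vertices in equal or consecutive layers.  With m repetitions of the period,
-- the sum of (d - 2)/(d + 1) is 1 + 21m/10, since a period in the middle has
-- degrees 4, 4, 4, 4, 3, 3.  A layer all of whose vertices are leaves of a spanning tree
-- would separate the layers on either side of it, so each of the 4m inner layers
-- contains a non-leaf, and at most (6m + 4) - 4m = 2m + 4 vertices are leaves.  A
-- caterpillar attains this, and 2m + 4 < 1 + 21m/10 as soon as m > 30.

open import Defs
open import Data.Bool.Base using (Bool; true; false; T; not; _∧_; _∨_; if_then_else_)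
open import Data.Bool.Properties using (T-≡; T-∧; T-∨; ∨-comm)
open import Data.Empty using (⊥)
open import Data.Fin.Base using (Fin; zero; suc; toℕ)
open import Data.Fin.Permutation using (↔⇒≡)
open import Data.Fin.Patterns using (0F; 1F; 2F; 3F; 4F; 5F)
import Data.Fin.Properties as Fin
open import Data.Fin.Subset using (Subset; ∣_∣; _∈_) renaming (_-_ to _∖_)
open import Data.Fin.Subset.Properties using (x∈p⇒∣p-x∣<∣p∣; x∈p∧x≢y⇒x∈p-y)
import Data.Integer.Base as ℤ
open import Data.Integer.Base using (+_; _⊖_)
import Data.Integer.Properties as ℤ
open import Data.List.Base using ([]; _∷_; _∷ʳ_)
open import Data.List.Membership.Propositional using () renaming (_∈_ to _∈ˡ_)
open import Data.List.Membership.Propositional.Properties using (∈-++⁺ʳ)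
open import Data.List.Relation.Unary.All as All using (All; []; _∷_)
open import Data.List.Relation.Unary.AllPairs as AllPairs using ([]; _∷_)
open import Data.List.Relation.Unary.Any using (here; there)
open import Data.List.Relation.Unary.Linked using (Linked; [-]; _∷_)
open import Data.List.Relation.Unary.Unique.Propositional using (Unique)
import Data.List.Relation.Unary.Unique.Propositional.Properties as Unique
open import Data.Nat.Base as ℕ
  using (ℕ; zero; suc; _+_; _*_; _≤_; z≤n; s≤s; z<s; s<s; NonZero; _≡ᵇ_; _<ᵇ_; _≤ᵇ_; ∣_-_∣)
import Data.Nat.Properties as ℕ
open import Data.Nat.Properties using (module ≤-Reasoning)
open import Data.Product.Base using (Σ-syntax; ∃-syntax; _×_; _,_; proj₁; proj₂)
open import Data.Rational.Base as ℚ using (ℚ; _/_; _<_)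
import Data.Rational.Properties as ℚ
open import Data.Rational.Unnormalised.Base as ℚᵘ using (mkℚᵘ; *≡*; *<*)
import Data.Rational.Unnormalised.Properties as ℚᵘ
open import Data.Sum.Base using (_⊎_; inj₁; inj₂)
open import Data.Unit.Base using (tt)
open import Data.Vec.Base using ([]; _∷_; tabulate)
import Data.Vec.Properties as Vec
open import Function.Base using (_∘_; id)
open import Function.Bundles using (Equivalence)
open import Relation.Binary.Construct.Closure.ReflexiveTransitive using (Star; ε; _◅_; _◅◅_; gmap; reverse)
open import Relation.Binary.PropositionalEquality
  using (refl; sym; trans; cong; cong₂; subst; module ≡-Reasoning)
open import Relation.Binary.PropositionalEquality.Core using (_≡_; _≢_)
open import Relation.Nullary using (yes; no; contradiction)
open import Relation.Nullary.Negation.Core using (¬_)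

open Equivalence using (to; from)

-- Cardinalities of subsets given by their characteristic functions

⟦_⟧ : Bool → ℕ
⟦ b ⟧ = if b then 1 else 0

∣∷∣ : ∀ {n} b (p : Subset n) → ∣ b ∷ p ∣ ≡ ⟦ b ⟧ + ∣ p ∣
∣∷∣ true  p = refl
∣∷∣ false p = refl

∣∷∣-any : ∀ {n} a (p : Subset n) → ∣ a ∷ p ∣ ≤ 1 + ∣ p ∣
∣∷∣-any true  p = ℕ.≤-refl
∣∷∣-any false p = ℕ.n≤1+n _

∣∷∣-out : ∀ {n} a (p : Subset n) → ¬ T a → ∣ a ∷ p ∣ ≤ ∣ p ∣
∣∷∣-out true  p ¬a = contradiction tt ¬a
∣∷∣-out false p ¬a = ℕ.≤-refl

∣∷∷∣-not-both : ∀ {n} a b (p : Subset n) → ¬ (T a × T b) → ∣ a ∷ b ∷ p ∣ ≤ 1 + ∣ p ∣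
∣∷∷∣-not-both true  b p ¬ab = s≤s (∣∷∣-out b p (λ tb → ¬ab (tt , tb)))
∣∷∷∣-not-both false b p ¬ab = ∣∷∣-any b p

∣none∣ : ∀ n → ∣ tabulate {n = n} (λ _ → false) ∣ ≡ 0
∣none∣ zero    = refl
∣none∣ (suc n) = ∣none∣ n

T⇒∈ : ∀ {n} (f : Fin n → Bool) {x} → T (f x) → x ∈ tabulate f
T⇒∈ f {x} fx = Vec.lookup⇒[]= x (tabulate f) (trans (Vec.lookup∘tabulate f x) (to T-≡ fx))

-- Deleting two distinct elements would lower the cardinality twice, below zero.
∣p∣≡1⇒unique : ∀ {n} {p : Subset n} {x y} → ∣ p ∣ ≡ 1 → x ∈ p → y ∈ p → x ≡ y
∣p∣≡1⇒unique {p = p} {x} {y} ∣p∣≡1 x∈p y∈p with x Fin.≟ y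
... | yes x≡y = x≡y
... | no  x≢y = contradiction (ℕ.<-≤-trans ∣p∖y∖x∣< ∣p∖y∣≤0) λ ()
  where
  ∣p∖y∖x∣< = x∈p⇒∣p-x∣<∣p∣ (x∈p∧x≢y⇒x∈p-y x∈p x≢y)
  ∣p∖y∣≤0 : ∣ p ∖ y ∣ ≤ 0
  ∣p∖y∣≤0 = ℕ.≤-pred (subst (∣ p ∖ y ∣ ℕ.<_) ∣p∣≡1 (x∈p⇒∣p-x∣<∣p∣ y∈p))

≡ᵇ-comm : ∀ m n → (m ≡ᵇ n) ≡ (n ≡ᵇ m)
≡ᵇ-comm zero    zero    = refl
≡ᵇ-comm zero    (suc n) = refl
≡ᵇ-comm (suc m) zero    = refl
≡ᵇ-comm (suc m) (suc n) = ≡ᵇ-comm m n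

≡ᵇ-refl : ∀ n → (n ≡ᵇ n) ≡ true
≡ᵇ-refl zero    = refl
≡ᵇ-refl (suc n) = ≡ᵇ-refl n

-- Forests in which every vertex has at most one larger neighbour

module Forest {n : ℕ} (up : Fin n → Fin n) where

  -- The test `<ᵇ` makes `x` a root whenever `up x` is not larger, so `up` can be total. Boolean
  -- tests on `toℕ` let common successors cancel by computation.
  link : Fin n → Fin n → Bool
  link x y = (toℕ x <ᵇ toℕ y) ∧ (toℕ y ≡ᵇ toℕ (up x))

  Link : Fin n → Fin n → Set
  Link x y = toℕ x ℕ.< toℕ y × y ≡ up x

  T-link : ∀ {x y} → T (link x y) → Link x y
  T-link {x} {y} l with to T-∧ l
  ... | x<y , y≡ = ℕ.<ᵇ⇒< _ _ x<y , Fin.toℕ-injective (ℕ.≡ᵇ⇒≡ _ _ y≡)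

  forest : Graph n
  forest = record
    { adj        = λ x y → link x y ∨ link y x
    ; adj-sym    = λ {x} {y} → subst T (∨-comm (link x y) (link y x))
    ; adj-irrefl = λ { {x} refl l → irrefl x (to T-∨ l) }
    }
    where
    irrefl : ∀ x → ¬ (T (link x x) ⊎ T (link x x))
    irrefl x (inj₁ l) = ℕ.<-irrefl refl (proj₁ (T-link {x} {x} l))
    irrefl x (inj₂ l) = ℕ.<-irrefl refl (proj₁ (T-link {x} {x} l))

  Adj⇒Link : ∀ {x y} → Adj forest x y → Link x y ⊎ Link y x
  Adj⇒Link {x} {y} l with to (T-∨ {link x y} {link y x}) l
  ... | inj₁ xy = inj₁ (T-link xy)
  ... | inj₂ yx = inj₂ (T-link yx)

  Link⇒Adj : ∀ {x} → toℕ x ℕ.< toℕ (up x) → Adj forest x (up x)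
  Link⇒Adj {x} x<up =
    from T-∨ (inj₁ (from T-∧ (ℕ.<⇒<ᵇ x<up , from T-≡ (≡ᵇ-refl (toℕ (up x))))))

  -- The second vertex has used up its only upward edge, so the path cannot turn.
  descend : ∀ a b l → Link b a → Unique (a ∷ b ∷ l) → Linked (Adj forest) (b ∷ l) →
            All (λ c → toℕ c ℕ.< toℕ a) (b ∷ l)
  descend a b [] (b<a , _) u e = b<a ∷ []
  descend a b (c ∷ l) (b<a , a≡) ((_ ∷ a≢c ∷ _) ∷ u) (bc ∷ e) with Adj⇒Link bc
  ... | inj₁ (_ , c≡) = contradiction (trans a≡ (sym c≡)) a≢c
  ... | inj₂ cb with descend b c l cb u e
  ...   | below = b<a ∷ All.map (λ c<b → ℕ.<-trans c<b b<a) below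

  -- The second alternative stands for a path whose last step is downwards.
  ascend : ∀ a b l z → Unique (a ∷ b ∷ (l ∷ʳ z)) → Linked (Adj forest) (a ∷ b ∷ (l ∷ʳ z)) →
           All (λ c → toℕ a ℕ.< toℕ c) (b ∷ (l ∷ʳ z)) ⊎ (up z ∈ˡ b ∷ l)
  ascend a b [] z ((_ ∷ a≢z ∷ _) ∷ _) (ab ∷ bz ∷ [-]) with Adj⇒Link bz | Adj⇒Link ab
  ... | inj₂ (_ , b≡) | _ = inj₂ (here (sym b≡))
  ... | inj₁ (b<z , _) | inj₁ (a<b , _) = inj₁ (a<b ∷ ℕ.<-trans a<b b<z ∷ [])
  ... | inj₁ (_ , z≡) | inj₂ (_ , a≡) = contradiction (trans a≡ (sym z≡)) a≢z
  ascend a b (c ∷ l) z ((_ ∷ a≢c ∷ _) ∷ u) (ab ∷ e@(bc ∷ _)) with ascend b c l z u e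
  ... | inj₂ z∈ = inj₂ (there z∈)
  ... | inj₁ above@(b<c ∷ _) with Adj⇒Link ab
  ...   | inj₁ (a<b , _) = inj₁ (a<b ∷ All.map (ℕ.<-trans a<b) above)
  ...   | inj₂ (_ , a≡) with Adj⇒Link bc
  ...     | inj₁ (_ , c≡) = contradiction (trans a≡ (sym c≡)) a≢c
  ...     | inj₂ (c<b , _) = contradiction c<b (ℕ.<-asym b<c)

  -- Follow the cycle from `a` round to `x`. If the edge from `x` to `a` rises, the rest either
  -- stays above `a`, which `x` does not, or returns to `x` from `up x`, which is `a` again. If it
  -- falls, the rest keeps falling and never gets back up to `x`.
  acyclic : Acyclic forest
  acyclic x (_ ∷ []) (s≤s () , _)
  acyclic x (a ∷ b ∷ l) (_ , (x∉@(_ ∷ x∉bl) ∷ u) , (xa ∷ e@(ab ∷ e′))) =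
    lemma (Adj⇒Link xa)
    where
    path : Unique (a ∷ b ∷ (l ∷ʳ x))
    path = Unique.++⁺ u ([] ∷ []) λ { (x∈ , here refl) → All.lookup x∉ x∈ refl }

    x∈end : x ∈ˡ b ∷ (l ∷ʳ x)
    x∈end = ∈-++⁺ʳ (b ∷ l) (here refl)

    lemma : Link x a ⊎ Link a x → ⊥
    lemma (inj₁ (x<a , a≡)) with ascend a b l x path e
    ... | inj₁ above = ℕ.<-asym x<a (All.lookup above x∈end)
    ... | inj₂ up∈ = All.lookup (AllPairs.head u) up∈ a≡
    lemma (inj₂ (a<x , x≡)) with Adj⇒Link ab
    ... | inj₁ (_ , b≡) = All.lookup x∉bl (here refl) (trans x≡ (sym b≡))
    ... | inj₂ ba = ℕ.<-asym a<x (All.lookup (descend a b (l ∷ʳ x) ba path e′) x∈end)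

open Forest using (forest)

-- Thickened paths

order : ℕ → ℕ
order m = m * 6 + 4

pattern shift x = suc (suc (suc (suc (suc (suc x)))))

-- The final block lists its top layer first, which lets the edges of the
-- caterpillar below run from smaller to larger indices.
layer : ∀ m → Fin (order m) → ℕ
layer zero    0F        = 1
layer zero    1F        = 1
layer zero    2F        = 0
layer zero    3F        = 0
layer (suc m) 0F        = 0
layer (suc m) 1F        = 0
layer (suc m) 2F        = 1
layer (suc m) 3F        = 1
layer (suc m) 4F        = 2
layer (suc m) 5F        = 3
layer (suc m) (shift x) = 4 + layer m x

thickPath : ∀ m → Graph (order m)
thickPath m = record
  { adj        = λ x y → not (toℕ x ≡ᵇ toℕ y) ∧ (∣ layer m x - layer m y ∣ ≤ᵇ 1)
  ; adj-sym    = λ {x} {y} → subst T (cong₂ (λ e d → not e ∧ (d ≤ᵇ 1))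
                   (≡ᵇ-comm (toℕ x) (toℕ y)) (ℕ.∣-∣-comm (layer m x) (layer m y)))
  ; adj-irrefl = λ { {x} refl a → irrefl (toℕ x) a }
  }
  where
  irrefl : ∀ k {b} → ¬ T (not (k ≡ᵇ k) ∧ b)
  irrefl k a rewrite ≡ᵇ-refl k = a

-- The degrees of thickPath m when every vertex of layer 0 has e neighbours
-- added below it.
thickDegree : ℕ → ∀ m → Fin (order m) → ℕ
thickDegree e zero    0F        = 3
thickDegree e zero    1F        = 3
thickDegree e zero    2F        = e + 3
thickDegree e zero    3F        = e + 3
thickDegree e (suc m) 0F        = e + 3
thickDegree e (suc m) 1F        = e + 3
thickDegree e (suc m) 2F        = 4
thickDegree e (suc m) 3F        = 4
thickDegree e (suc m) 4F        = 3
thickDegree e (suc m) 5F        = 3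
thickDegree e (suc m) (shift x) = thickDegree 1 m x

thickDegree-1 : ∀ m x → thickDegree 1 m x ≡ ⟦ layer m x <ᵇ 1 ⟧ + thickDegree 0 m x
thickDegree-1 zero    0F        = refl
thickDegree-1 zero    1F        = refl
thickDegree-1 zero    2F        = refl
thickDegree-1 zero    3F        = refl
thickDegree-1 (suc m) 0F        = refl
thickDegree-1 (suc m) 1F        = refl
thickDegree-1 (suc m) 2F        = refl
thickDegree-1 (suc m) 3F        = refl
thickDegree-1 (suc m) 4F        = refl
thickDegree-1 (suc m) 5F        = refl
thickDegree-1 (suc m) (shift x) = refl

∣layer₀∣ : ∀ m → ∣ tabulate (λ x → layer m x <ᵇ 1) ∣ ≡ 2
∣layer₀∣ zero    = refl
∣layer₀∣ (suc m) = cong (2 ℕ.+_) (∣none∣ (order m))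

-- A block put in front touches the rest only through `5F`, alone in layer 3, whose neighbours there
-- are the two vertices of the old layer 0.
degree-thickPath : ∀ m x → degree (thickPath m) x ≡ thickDegree 0 m x
degree-thickPath zero    0F        = refl
degree-thickPath zero    1F        = refl
degree-thickPath zero    2F        = refl
degree-thickPath zero    3F        = refl
degree-thickPath (suc m) 0F        = cong (3 ℕ.+_) (∣none∣ (order m))
degree-thickPath (suc m) 1F        = cong (3 ℕ.+_) (∣none∣ (order m))
degree-thickPath (suc m) 2F        = cong (4 ℕ.+_) (∣none∣ (order m))
degree-thickPath (suc m) 3F        = cong (4 ℕ.+_) (∣none∣ (order m))
degree-thickPath (suc m) 4F        = cong (3 ℕ.+_) (∣none∣ (order m))
degree-thickPath (suc m) 5F        = cong (1 ℕ.+_) (∣layer₀∣ m)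
degree-thickPath (suc m) (shift x) = begin
  ∣ (layer m x <ᵇ 1) ∷ neighbours (thickPath m) x ∣     ≡⟨ ∣∷∣ (layer m x <ᵇ 1) (neighbours (thickPath m) x) ⟩
  ⟦ layer m x <ᵇ 1 ⟧ + degree (thickPath m) x           ≡⟨ cong (⟦ layer m x <ᵇ 1 ⟧ ℕ.+_) (degree-thickPath m x) ⟩
  ⟦ layer m x <ᵇ 1 ⟧ + thickDegree 0 m x                ≡⟨ thickDegree-1 m x ⟨
  thickDegree 1 m x                                     ∎
  where open ≡-Reasoning

thickDegree-3∨4 : ∀ m {e} → e ≡ 0 ⊎ e ≡ 1 → ∀ x → thickDegree e m x ≡ 3 ⊎ thickDegree e m x ≡ 4
thickDegree-3∨4 zero    _           0F        = inj₁ refl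
thickDegree-3∨4 zero    _           1F        = inj₁ refl
thickDegree-3∨4 zero    (inj₁ refl) 2F        = inj₁ refl
thickDegree-3∨4 zero    (inj₂ refl) 2F        = inj₂ refl
thickDegree-3∨4 zero    (inj₁ refl) 3F        = inj₁ refl
thickDegree-3∨4 zero    (inj₂ refl) 3F        = inj₂ refl
thickDegree-3∨4 (suc m) (inj₁ refl) 0F        = inj₁ refl
thickDegree-3∨4 (suc m) (inj₂ refl) 0F        = inj₂ refl
thickDegree-3∨4 (suc m) (inj₁ refl) 1F        = inj₁ refl
thickDegree-3∨4 (suc m) (inj₂ refl) 1F        = inj₂ refl
thickDegree-3∨4 (suc m) _           2F        = inj₂ refl
thickDegree-3∨4 (suc m) _           3F        = inj₂ refl
thickDegree-3∨4 (suc m) _           4F        = inj₁ refl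
thickDegree-3∨4 (suc m) _           5F        = inj₁ refl
thickDegree-3∨4 (suc m) _           (shift x) = thickDegree-3∨4 m (inj₂ refl) x

thickPath-degrees : ∀ m x → degree (thickPath m) x ≡ 3 ⊎ degree (thickPath m) x ≡ 4
thickPath-degrees m x =
  subst (λ d → d ≡ 3 ⊎ d ≡ 4) (sym (degree-thickPath m x)) (thickDegree-3∨4 m (inj₁ refl) x)

order-nonZero : ∀ m → NonZero (order m)
order-nonZero zero    = _
order-nonZero (suc m) = _

-- A spanning caterpillar

entry : ∀ m → Fin (order m)
entry zero    = 3F
entry (suc m) = 0F

-- The spine takes one vertex from each layer but the last: `0F`, `2F`, `4F`, `5F` in each period,
-- then `3F` in the final block. All other vertices hang from it as leaves. The last `3F` is its own
-- image, hence a root.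
up : ∀ m → Fin (order m) → Fin (order m)
up zero    _         = 3F
up (suc m) 0F        = 2F
up (suc m) 1F        = 2F
up (suc m) 2F        = 4F
up (suc m) 3F        = 4F
up (suc m) 4F        = 5F
up (suc m) 5F        = shift (entry m)
up (suc m) (shift x) = shift (up m x)

root : ∀ m → Fin (order m)
root zero    = 3F
root (suc m) = shift (root m)

caterpillar : ∀ m → Graph (order m)
caterpillar m = forest (up m)

module _ (m : ℕ) where

  private
    _⟶*_ = Star (Adj (caterpillar (suc m)))

  shift⟶* : ∀ {x y} → Star (Adj (caterpillar m)) x y → shift x ⟶* shift y
  shift⟶* = gmap (λ x → shift x) id

  module _ (entry⟶*root : Star (Adj (caterpillar m)) (entry m) (root m)) where

    5⟶*root : 5F ⟶* root (suc m)
    5⟶*root = Forest.Link⇒Adj (up (suc m)) {5F} (ℕ.m≤m+n 6 (toℕ (entry m))) ◅ shift⟶* entry⟶*root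

    4⟶*root : 4F ⟶* root (suc m)
    4⟶*root = _◅_ {j = 5F} tt 5⟶*root

    2⟶*root : 2F ⟶* root (suc m)
    2⟶*root = _◅_ {j = 4F} tt 4⟶*root

caterpillar-to-root : ∀ m x → Star (Adj (caterpillar m)) x (root m)
caterpillar-to-root zero    0F        = tt ◅ ε
caterpillar-to-root zero    1F        = tt ◅ ε
caterpillar-to-root zero    2F        = tt ◅ ε
caterpillar-to-root zero    3F        = ε
caterpillar-to-root (suc m) (shift x) = shift⟶* m (caterpillar-to-root m x)
caterpillar-to-root (suc m) 0F        = _◅_ {j = 2F} tt (2⟶*root m (caterpillar-to-root m (entry m)))
caterpillar-to-root (suc m) 1F        = _◅_ {j = 2F} tt (2⟶*root m (caterpillar-to-root m (entry m)))
caterpillar-to-root (suc m) 2F        = 2⟶*root m (caterpillar-to-root m (entry m))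
caterpillar-to-root (suc m) 3F        = _◅_ {j = 4F} tt (4⟶*root m (caterpillar-to-root m (entry m)))
caterpillar-to-root (suc m) 4F        = 4⟶*root m (caterpillar-to-root m (entry m))
caterpillar-to-root (suc m) 5F        = 5⟶*root m (caterpillar-to-root m (entry m))

caterpillar-connected : ∀ m → Connected (caterpillar m)
caterpillar-connected m = order-nonZero m , λ x y →
  caterpillar-to-root m x ◅◅
  reverse (λ {a} {b} → Graph.adj-sym (caterpillar m) {a} {b}) (caterpillar-to-root m y)

layer-entry : ∀ m → layer m (entry m) ≡ 0
layer-entry zero    = refl
layer-entry (suc m) = refl

up-edge : ∀ m x → toℕ x ℕ.< toℕ (up m x) → Adj (thickPath m) x (up m x)
up-edge zero    0F        _ = tt
up-edge zero    1F        _ = tt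
up-edge zero    2F        _ = tt
up-edge zero    3F        x<up = contradiction x<up (ℕ.<-irrefl refl)
up-edge (suc m) 0F        _ = tt
up-edge (suc m) 1F        _ = tt
up-edge (suc m) 2F        _ = tt
up-edge (suc m) 3F        _ = tt
up-edge (suc m) 4F        _ = tt
up-edge (suc m) 5F        _ rewrite layer-entry m = tt
up-edge (suc m) (shift x) (s<s (s<s (s<s (s<s (s<s (s<s x<up)))))) = up-edge m x x<up

caterpillar⊆thickPath : ∀ m {x y} → Adj (caterpillar m) x y → Adj (thickPath m) x y
caterpillar⊆thickPath m {x} {y} xy with Forest.Adj⇒Link (up m) {x} {y} xy
... | inj₁ (x<y , refl) = up-edge m x x<y
... | inj₂ (y<x , refl) = Graph.adj-sym (thickPath m) {y} {x} (up-edge m y y<x)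

caterpillar-spanning : ∀ m → IsSpanningTree (thickPath m) (caterpillar m)
caterpillar-spanning m =
  (λ {x} {y} → caterpillar⊆thickPath m {x} {y}) , caterpillar-connected m , Forest.acyclic (up m)

thickPath-connected : ∀ m → Connected (thickPath m)
thickPath-connected m = order-nonZero m , λ x y →
  gmap id (λ {a} {b} → caterpillar⊆thickPath m {a} {b}) (proj₂ (caterpillar-connected m) x y)

-- The degrees of caterpillar m when the entry has e neighbours added below it.
caterpillarDegree : ℕ → ∀ m → Fin (order m) → ℕ
caterpillarDegree e zero    0F        = 1
caterpillarDegree e zero    1F        = 1
caterpillarDegree e zero    2F        = 1
caterpillarDegree e zero    3F        = e + 3
caterpillarDegree e (suc m) 0F        = e + 1
caterpillarDegree e (suc m) 1F        = 1
caterpillarDegree e (suc m) 2F        = 3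
caterpillarDegree e (suc m) 3F        = 1
caterpillarDegree e (suc m) 4F        = 3
caterpillarDegree e (suc m) 5F        = 2
caterpillarDegree e (suc m) (shift x) = caterpillarDegree 1 m x

caterpillarDegree-1 : ∀ m x →
  caterpillarDegree 1 m x ≡ ⟦ toℕ x ≡ᵇ toℕ (entry m) ⟧ + caterpillarDegree 0 m x
caterpillarDegree-1 zero    0F        = refl
caterpillarDegree-1 zero    1F        = refl
caterpillarDegree-1 zero    2F        = refl
caterpillarDegree-1 zero    3F        = refl
caterpillarDegree-1 (suc m) 0F        = refl
caterpillarDegree-1 (suc m) 1F        = refl
caterpillarDegree-1 (suc m) 2F        = refl
caterpillarDegree-1 (suc m) 3F        = refl
caterpillarDegree-1 (suc m) 4F        = refl
caterpillarDegree-1 (suc m) 5F        = refl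
caterpillarDegree-1 (suc m) (shift x) = refl

-- This is the row of `5F` restricted to the later blocks; `false` is what the link in the opposite
-- direction computes to.
∣entry∣ : ∀ m → ∣ tabulate {n = order m} (λ x → (toℕ x ≡ᵇ toℕ (entry m)) ∨ false) ∣ ≡ 1
∣entry∣ zero    = refl
∣entry∣ (suc m) = cong suc (∣none∣ (order m))

degree-caterpillar : ∀ m x → degree (caterpillar m) x ≡ caterpillarDegree 0 m x
degree-caterpillar zero    0F        = refl
degree-caterpillar zero    1F        = refl
degree-caterpillar zero    2F        = refl
degree-caterpillar zero    3F        = refl
degree-caterpillar (suc m) 0F        = cong (1 ℕ.+_) (∣none∣ (order m))
degree-caterpillar (suc m) 1F        = cong (1 ℕ.+_) (∣none∣ (order m))
degree-caterpillar (suc m) 2F        = cong (3 ℕ.+_) (∣none∣ (order m))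
degree-caterpillar (suc m) 3F        = cong (1 ℕ.+_) (∣none∣ (order m))
degree-caterpillar (suc m) 4F        = cong (3 ℕ.+_) (∣none∣ (order m))
degree-caterpillar (suc m) 5F        = cong (1 ℕ.+_) (∣entry∣ m)
degree-caterpillar (suc m) (shift x) = begin
  ∣ isEntry ∷ neighbours (caterpillar m) x ∣     ≡⟨ ∣∷∣ isEntry (neighbours (caterpillar m) x) ⟩
  ⟦ isEntry ⟧ + degree (caterpillar m) x         ≡⟨ cong (⟦ isEntry ⟧ ℕ.+_) (degree-caterpillar m x) ⟩
  ⟦ isEntry ⟧ + caterpillarDegree 0 m x          ≡⟨ caterpillarDegree-1 m x ⟨
  caterpillarDegree 1 m x                        ∎
  where
  open ≡-Reasoning
  isEntry = toℕ x ≡ᵇ toℕ (entry m)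

-- Behind another block the entry is no leaf, so each period gives the two leaves `1F` and `3F`, and
-- the final block gives three.
∣leaves₁∣ : ∀ m → ∣ tabulate (λ x → caterpillarDegree 1 m x ≡ᵇ 1) ∣ ≡ 3 + m * 2
∣leaves₁∣ zero    = refl
∣leaves₁∣ (suc m) = cong (2 ℕ.+_) (∣leaves₁∣ m)

∣leaves-caterpillar∣ : ∀ m → ∣ leaves (caterpillar (suc m)) ∣ ≡ 4 + suc m * 2
∣leaves-caterpillar∣ m = begin
  ∣ leaves (caterpillar (suc m)) ∣
    ≡⟨ cong ∣_∣ (Vec.tabulate-cong (λ x → cong (_≡ᵇ 1) (degree-caterpillar (suc m) x))) ⟩
  ∣ tabulate (λ x → caterpillarDegree 0 (suc m) x ≡ᵇ 1) ∣
    -- The first period has a third leaf, the start `0F` of the spine. This needs at least one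
    -- period: with none, the caterpillar is a star with only three leaves.
    ≡⟨ cong (3 ℕ.+_) (∣leaves₁∣ m) ⟩
  4 + suc m * 2 ∎
  where open ≡-Reasoning

-- Upper bound on the number of leaves

module _ {n : ℕ} {F : Graph n} where

  leaf⇒unique-neighbour : ∀ {x y z} → T (degree F x ≡ᵇ 1) → Adj F x y → Adj F x z → y ≡ z
  leaf⇒unique-neighbour {x} leaf xy xz =
    ∣p∣≡1⇒unique (ℕ.≡ᵇ⇒≡ _ _ leaf) (T⇒∈ (Graph.adj F x) xy) (T⇒∈ (Graph.adj F x) xz)

  -- A walk that starts below a layer consisting of leaves can enter this layer
  -- but has to leave it downwards again.
  leaf-layer-separates : (ℓ : Fin n → ℕ) → (∀ {x y} → Adj F x y → ℓ y ≤ suc (ℓ x)) →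
    ∀ j → (∀ x → ℓ x ≡ j → T (degree F x ≡ᵇ 1)) →
    ∀ {a b} → ℓ a ℕ.< j → Star (Adj F) a b → ¬ (j ℕ.< ℓ b)
  leaf-layer-separates ℓ step j leaf a<j walk j<b = escape (inj₁ a<j) walk
    where
    Stuck : Fin n → Set
    Stuck x = ℓ x ℕ.< j ⊎ (ℓ x ≡ j × (∀ {y} → Adj F x y → ℓ y ℕ.< j))

    stuck-step : ∀ {x y} → Adj F x y → Stuck x → Stuck y
    stuck-step xy (inj₂ (_ , low)) = inj₁ (low xy)
    stuck-step {x} {y} xy (inj₁ x<j) with ℕ.m≤n⇒m<n∨m≡n (ℕ.≤-trans (step xy) x<j)
    ... | inj₁ y<j = inj₁ y<j
    -- The leaf `y` has just been entered from `x`, so its only exit leads back to `x`, below layer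
    -- `j`.
    ... | inj₂ y≡j = inj₂ (y≡j , λ yz →
      subst (λ v → ℓ v ℕ.< j) (leaf⇒unique-neighbour (leaf y y≡j) (Graph.adj-sym F xy) yz) x<j)

    escape : ∀ {x} → Stuck x → Star (Adj F) x _ → ⊥
    escape (inj₁ b<j)       ε = ℕ.<-asym b<j j<b
    escape (inj₂ (b≡j , _)) ε = ℕ.<-irrefl (sym b≡j) j<b
    escape s (xy ◅ w) = escape (stuck-step xy s) w

thickPath-step : ∀ m {x y} → Adj (thickPath m) x y → layer m y ≤ suc (layer m x)
thickPath-step m {x} {y} xy = begin
  layer m y                                     ≤⟨ ℕ.m≤n+∣n-m∣ (layer m y) (layer m x) ⟩
  layer m x + ∣ layer m x - layer m y ∣         ≤⟨ ℕ.+-monoʳ-≤ (layer m x) (ℕ.≤ᵇ⇒≤ _ 1 close) ⟩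
  layer m x + 1                                 ≡⟨ ℕ.+-comm (layer m x) 1 ⟩
  suc (layer m x)                               ∎
  where
  open ≤-Reasoning
  close = proj₂ (to (T-∧ {not (toℕ x ≡ᵇ toℕ y)}) xy)

top : ∀ m → Fin (order m)
top zero    = 0F
top (suc m) = shift (top m)

layer-top : ∀ m → layer m (top m) ≡ 1 + m * 4
layer-top zero    = refl
layer-top (suc m) = cong (4 ℕ.+_) (layer-top m)

FullLayer : ∀ m → (Fin (order m) → Bool) → ℕ → Set
FullLayer m p j = ∀ x → layer m x ≡ j → T (p x)

module _ {m : ℕ} {p : Fin (order (suc m)) → Bool} where

  full₀ : T (p 0F) × T (p 1F) → FullLayer (suc m) p 0
  full₀ (p₀ , p₁) 0F refl = p₀
  full₀ (p₀ , p₁) 1F refl = p₁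
  full₀ _ (shift _) ()

  full₁ : T (p 2F) × T (p 3F) → FullLayer (suc m) p 1
  full₁ (p₂ , p₃) 2F refl = p₂
  full₁ (p₂ , p₃) 3F refl = p₃
  full₁ _ (shift _) ()

  full₂ : T (p 4F) → FullLayer (suc m) p 2
  full₂ p₄ 4F refl = p₄
  full₂ _ (shift _) ()

  full₃ : T (p 5F) → FullLayer (suc m) p 3
  full₃ p₅ 5F refl = p₅
  full₃ _ (shift _) ()

  full-shift : ∀ {j} → FullLayer m (λ x → p (shift x)) j → FullLayer (suc m) p (4 + j)
  full-shift full (shift x) refl = full x refl

module _ (m : ℕ) {p : Fin (order (suc m)) → Bool} where

  private rest = tabulate (λ x → p (shift x))

  -- Layers 1, 2, 3 have sizes 2, 1, 1, and each must miss a vertex, so at most one of the four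
  -- vertices is counted.
  inner-block : (∀ {j} → 0 ℕ.< j → j ≤ suc m * 4 → ¬ FullLayer (suc m) p j) →
                ∣ p 2F ∷ p 3F ∷ p 4F ∷ p 5F ∷ rest ∣ ≤ 1 + ∣ rest ∣
  inner-block ¬full = begin
    ∣ p 2F ∷ p 3F ∷ p 4F ∷ p 5F ∷ rest ∣
      ≤⟨ ∣∷∷∣-not-both (p 2F) (p 3F) (p 4F ∷ p 5F ∷ rest) (¬full z<s (s≤s z≤n) ∘ full₁) ⟩
    1 + ∣ p 4F ∷ p 5F ∷ rest ∣
      ≤⟨ s≤s (∣∷∣-out (p 4F) (p 5F ∷ rest) (¬full z<s (s≤s (s≤s z≤n)) ∘ full₂)) ⟩
    1 + ∣ p 5F ∷ rest ∣
      ≤⟨ s≤s (∣∷∣-out (p 5F) rest (¬full z<s (s≤s (s≤s (s≤s z≤n))) ∘ full₃)) ⟩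
    1 + ∣ rest ∣ ∎
    where open ≤-Reasoning

-- This serves the blocks behind the first period, whose layer 0 is an inner layer of the whole
-- graph. Only the last layer, `1 + m * 4`, may be full; hence the final block contributes up to 3.
no-full-layer⇒∣p∣≤ : ∀ m {p} → (∀ {j} → j ≤ m * 4 → ¬ FullLayer m p j) →
                      ∣ tabulate p ∣ ≤ 3 + m * 2
no-full-layer⇒∣p∣≤ zero {p} ¬full = begin
  ∣ p 0F ∷ p 1F ∷ p 2F ∷ p 3F ∷ [] ∣  ≤⟨ ∣∷∣-any (p 0F) (p 1F ∷ p 2F ∷ p 3F ∷ []) ⟩
  1 + ∣ p 1F ∷ p 2F ∷ p 3F ∷ [] ∣     ≤⟨ s≤s (∣∷∣-any (p 1F) (p 2F ∷ p 3F ∷ [])) ⟩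
  2 + ∣ p 2F ∷ p 3F ∷ [] ∣            ≤⟨ s≤s (s≤s (∣∷∷∣-not-both (p 2F) (p 3F) [] (¬full z≤n ∘ full))) ⟩
  3                                   ∎
  where
  open ≤-Reasoning
  full : T (p 2F) × T (p 3F) → FullLayer zero p 0
  full (p₂ , p₃) 2F refl = p₂
  full (p₂ , p₃) 3F refl = p₃
no-full-layer⇒∣p∣≤ (suc m) {p} ¬full = begin
  ∣ tabulate p ∣
    ≤⟨ ∣∷∷∣-not-both (p 0F) (p 1F) (tabulate (λ x → p (suc (suc x)))) (¬full z≤n ∘ full₀) ⟩
  1 + ∣ tabulate (λ x → p (suc (suc x))) ∣
    ≤⟨ s≤s (inner-block m {p} (λ _ → ¬full)) ⟩
  2 + ∣ tabulate (λ x → p (shift x)) ∣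
    ≤⟨ s≤s (s≤s (no-full-layer⇒∣p∣≤ m (λ j≤ → ¬full (ℕ.+-monoʳ-≤ 4 j≤) ∘ full-shift))) ⟩
  3 + suc m * 2 ∎
  where open ≤-Reasoning

-- Here layer 0 is an end and may be full too, which costs one more than in the bound for the later
-- blocks.
no-full-inner-layer⇒∣p∣≤ : ∀ m {p} →
  (∀ {j} → 0 ℕ.< j → j ≤ suc m * 4 → ¬ FullLayer (suc m) p j) → ∣ tabulate p ∣ ≤ 4 + suc m * 2
no-full-inner-layer⇒∣p∣≤ m {p} ¬full = begin
  ∣ tabulate p ∣
    ≤⟨ ∣∷∣-any (p 0F) (tabulate (λ x → p (suc x))) ⟩
  1 + ∣ tabulate (λ x → p (suc x)) ∣
    ≤⟨ s≤s (∣∷∣-any (p 1F) (tabulate (λ x → p (suc (suc x))))) ⟩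
  2 + ∣ tabulate (λ x → p (suc (suc x))) ∣
    ≤⟨ s≤s (s≤s (inner-block m {p} ¬full)) ⟩
  3 + ∣ tabulate (λ x → p (shift x)) ∣
    ≤⟨ ℕ.+-monoʳ-≤ 3 (no-full-layer⇒∣p∣≤ m (λ j≤ → ¬full z<s (ℕ.+-monoʳ-≤ 4 j≤) ∘ full-shift)) ⟩
  4 + suc m * 2 ∎
  where open ≤-Reasoning

maxLeaves-thickPath : ∀ m → MaxLeaves (thickPath (suc m)) (4 + suc m * 2)
maxLeaves-thickPath m =
  (caterpillar (suc m) , caterpillar-spanning (suc m) , ∣leaves-caterpillar∣ m) ,
  λ { F (F⊆G , (_ , connected) , _) → no-full-inner-layer⇒∣p∣≤ m λ {j} 0<j j≤ full →
      leaf-layer-separates {F = F} (layer (suc m))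
        (λ {x} {y} xy → thickPath-step (suc m) {x} {y} (F⊆G xy)) j full 0<j
        (connected 0F (top (suc m)))
        -- The last layer is number `1 + suc m * 4`, so `top` lies strictly above every inner layer,
        -- as `0F` lies strictly below.
        (subst (j ℕ.<_) (sym (layer-top (suc m))) (s≤s j≤)) }

-- The degree sum, in units of 1/20 (so that 1/4 = 5/20 and 2/5 = 8/20)

twentieths : ℕ → ℚ
twentieths k = + k / 20

open import Algebra.Properties.CommutativeMonoid.Sum ℚ.+-0-commutativeMonoid using (sum; sum-cong-≗)

-- Since `_/_` reduces fractions, the identity is checked on unnormalised rationals, where the
-- denominators are 20 and 400.
twentieths-+ : ∀ a b → twentieths a ℚ.+ twentieths b ≡ twentieths (a + b)
twentieths-+ a b = ℚ.toℚᵘ-injective (begin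
  ℚ.toℚᵘ (twentieths a ℚ.+ twentieths b)            ≈⟨ ℚ.toℚᵘ-homo-+ (twentieths a) (twentieths b) ⟩
  ℚ.toℚᵘ (twentieths a) ℚᵘ.+ ℚ.toℚᵘ (twentieths b)  ≈⟨ ℚᵘ.+-cong (unnormalised a) (unnormalised b) ⟩
  mkℚᵘ (+ a) 19 ℚᵘ.+ mkℚᵘ (+ b) 19                  ≈⟨ *≡* same ⟩
  mkℚᵘ (+ (a + b)) 19                               ≈⟨ unnormalised (a + b) ⟨
  ℚ.toℚᵘ (twentieths (a + b))                       ∎)
  where
  open ℚᵘ.≃-Reasoning
  unnormalised : ∀ k → ℚ.toℚᵘ (twentieths k) ℚᵘ.≃ mkℚᵘ (+ k) 19
  unnormalised k = ℚ.toℚᵘ-fromℚᵘ (mkℚᵘ (+ k) 19)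
  same : (+ a ℤ.* + 20 ℤ.+ + b ℤ.* + 20) ℤ.* + 20 ≡ + (a + b) ℤ.* + 400
  same = trans (cong (ℤ._* + 20) (sym (ℤ.*-distribʳ-+ (+ 20) (+ a) (+ b))))
               (ℤ.*-assoc (+ (a + b)) (+ 20) (+ 20))

<-twentieths : ∀ k w → k * 20 ℕ.< w → (+ k / 1) < twentieths w
<-twentieths k w k*20<w = ℚ.toℚᵘ-cancel-< (begin-strict
  ℚ.toℚᵘ (+ k / 1)        ≃⟨ ℚ.toℚᵘ-fromℚᵘ (mkℚᵘ (+ k) 0) ⟩
  mkℚᵘ (+ k) 0            <⟨ *<* cross ⟩
  mkℚᵘ (+ w) 19           ≃⟨ ℚ.toℚᵘ-fromℚᵘ (mkℚᵘ (+ w) 19) ⟨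
  ℚ.toℚᵘ (twentieths w)   ∎)
  where
  open ℚᵘ.≤-Reasoning
  cross : + k ℤ.* + 20 ℤ.< + w ℤ.* + 1
  cross rewrite ℤ.*-identityʳ (+ w) | sym (ℤ.pos-* k 20) = ℤ.+<+ k*20<w

weight : ℕ → ℚ
weight d = (d ⊖ 2) / suc d

add-block : ∀ a b c d e f w →
  twentieths a ℚ.+ (twentieths b ℚ.+ (twentieths c ℚ.+
    (twentieths d ℚ.+ (twentieths e ℚ.+ (twentieths f ℚ.+ twentieths w))))) ≡
  twentieths (a + (b + (c + (d + (e + (f + w))))))
add-block a b c d e f w =
  push a (push b (push c (push d (push e (twentieths-+ f w)))))
  where
  push : ∀ a {q v} → q ≡ twentieths v → twentieths a ℚ.+ q ≡ twentieths (a + v)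
  push a {v = v} refl = twentieths-+ a v

-- The final block has degrees 3, 3, 4, 4 and weighs 5 + 5 + 8 + 8 = 26; a period with a block
-- before it weighs 4 · 8 + 2 · 5 = 42.
sum-thickDegree-1 : ∀ m → sum (λ x → weight (thickDegree 1 m x)) ≡ twentieths (26 + m * 42)
sum-thickDegree-1 zero    = refl
sum-thickDegree-1 (suc m) =
  trans (cong (λ s → weight 4 ℚ.+ (weight 4 ℚ.+ (weight 4 ℚ.+ (weight 4 ℚ.+ (weight 3 ℚ.+ (weight 3 ℚ.+ s))))))
              (sum-thickDegree-1 m))
        (add-block 8 8 8 8 5 5 (26 + m * 42))

-- The first period has degrees 3, 3, 4, 4, 3, 3 and weighs 36, and 62 = 36 + 26.
degreeSum-thickPath : ∀ m → degreeSum (thickPath (suc m)) ≡ twentieths (62 + m * 42)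
degreeSum-thickPath m =
  trans (sum-cong-≗ (λ x → cong weight (degree-thickPath (suc m) x)))
  (trans (cong (λ s → weight 3 ℚ.+ (weight 3 ℚ.+ (weight 4 ℚ.+ (weight 4 ℚ.+ (weight 3 ℚ.+ (weight 3 ℚ.+ s))))))
               (sum-thickDegree-1 m))
         (add-block 5 5 8 8 5 5 (26 + m * 42)))

-- Multiplied by 20, the claim is 120 + 40m < 62 + 42m, that is, m > 29.
maxLeaves<degreeSum : ∀ m → 30 ≤ m → (+ (4 + suc m * 2) / 1) < degreeSum (thickPath (suc m))
maxLeaves<degreeSum m 30≤m =
  subst ((+ (4 + suc m * 2) / 1) <_) (sym (degreeSum-thickPath m))
    (<-twentieths (4 + suc m * 2) (62 + m * 42) (begin-strict
      (4 + suc m * 2) * 20  ≡⟨ cong (120 ℕ.+_) (ℕ.*-assoc m 2 20) ⟩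
      120 + m * 40          <⟨ ℕ.+-monoˡ-< (m * 40) (ℕ.≤ᵇ⇒≤ 121 122 tt) ⟩
      62 + 60 + m * 40      ≤⟨ ℕ.+-monoˡ-≤ (m * 40) (ℕ.+-monoʳ-≤ 62 (ℕ.*-monoˡ-≤ 2 30≤m)) ⟩
      62 + m * 2 + m * 40   ≡⟨ cong (62 ℕ.+_) (ℕ.*-distribˡ-+ m 2 40) ⟨
      62 + m * 42           ∎))
  where open ≤-Reasoning

-- Pairwise non-isomorphism and the infinite family

-- Isomorphic graphs have equally many vertices, and `6m + 4` determines `m`.
thickPath-injective : ∀ {i j} → thickPath i ≅ thickPath j → i ≡ j
thickPath-injective {i} {j} (f , _) =
  ℕ.*-cancelʳ-≡ i j 6 (ℕ.+-cancelʳ-≡ 4 (i * 6) (j * 6) (↔⇒≡ f))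

few-leaves : ∀ m → 30 ≤ m →
  Connected (thickPath (suc m)) ×
  (∀ x → degree (thickPath (suc m)) x ≡ 3 ⊎ degree (thickPath (suc m)) x ≡ 4) ×
  (∃[ k ] MaxLeaves (thickPath (suc m)) k × (+ k / 1) < degreeSum (thickPath (suc m)))
few-leaves m 30≤m =
  thickPath-connected (suc m) ,
  thickPath-degrees (suc m) ,
  4 + suc m * 2 ,
  maxLeaves-thickPath m ,
  maxLeaves<degreeSum m 30≤m

mainTheorem3 : Σ[ order ∈ (ℕ → ℕ) ]
    Σ[ G ∈ (∀ i → Graph (order i)) ]
    (∀ i j → i ≢ j → ¬ (G i ≅ G j)) ×
    (∀ i →
    Connected (G i) ×
    (∀ x → degree (G i) x ≡ 3 ⊎ degree (G i) x ≡ 4) ×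
    (∃[ k ] MaxLeaves (G i) k × (+ k / 1) < degreeSum (G i)))
mainTheorem3 =
  -- The family starts at 31 periods, the first number for which the inequality is strict.
  (λ i → order (suc (30 + i))) ,
  (λ i → thickPath (suc (30 + i))) ,
  (λ i j i≢j iso →
    i≢j (ℕ.+-cancelˡ-≡ 31 i j (thickPath-injective {suc (30 + i)} {suc (30 + j)} iso))) ,
  λ i → few-leaves (30 + i) (ℕ.m≤m+n 30 i)
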